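{- Let $\lambda$ be a partition (respectively a strict partition) and let $c\ge1$. Then the number of pairs $(T,u)$, where $T$ is a standard Young tableau of shape $[\lambda]$ (respectively a shifted standard Young tableau of shape $[\lambda]^{\mathrm{sh}}$) and $(T,u)$ is a horizontal adjacency lying in column $c$, equals the number of standard Young tableaux of shape $[\lambda]$ (respectively shifted standard Young tableaux of shape $[\lambda]^{\mathrm{sh}}$) whose largest entry $|\lambda|$ lies in a column with index at least $c+1$.
   Context: Matrix coordinates (row $i$, column $j$). $[\lambda]=\{(i,j):i\in[\ell(\lambda)],j\in[\lambda_i]\}$; for strict $\lambda$, $[\lambda]^{\mathrm{sh}}=\{(i,j+i-1):i\in[\ell(\lambda)],j\in[\lambda_i]\}$. A (shifted) standard Young tableau is a bijection from the cell set $D$ to $[|\lambda|]$ increasing along rows (left to right) and columns (top to bottom). For such $T$ and $u=(i,j)\in D$, $(T,u)$ is a horizontal adjacency if $(i,j+1)\in D$ and $T(i,j+1)=T(u)+1$; it lies in column $j$ (and row $i$). -}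

module Defs where

open import Data.Nat using (ℕ; suc; _+_; _∸_; _≤_; _<_; _≥_; _>_)
open import Data.Nat.Properties using (suc-injective; +-cancelʳ-≡)
open import Data.Fin as Fin using (Fin; toℕ)
open import Data.Fin.Properties using (toℕ-injective)
open import Data.List using (List; length; lookup)
open import Data.List.Relation.Unary.All using (All)
open import Data.List.Relation.Unary.Linked using (Linked)
open import Data.Product using (Σ-syntax; ∃-syntax; _×_; _,_; proj₁; proj₂)
open import Data.Product.Properties using (,-injective)
open import Function.Bundles using (Inverse)
open import Function.Definitions using (Injective; Bijective)
open import Level using (0ℓ)
open import Relation.Binary.Bundles using (Setoid)
open import Relation.Binary.PropositionalEquality using (_≡_; refl; sym; trans; setoid)

record Partition : Set where
  field
    parts      : List ℕ
    positive   : All (1 ≤_) parts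
    decreasing : Linked _≥_ parts

record StrictPartition : Set where
  field
    parts      : List ℕ
    positive   : All (1 ≤_) parts
    decreasing : Linked _>_ parts

-- A set of (row , column) positions, presented as an injectively indexed
-- family so that cells have no redundant membership proofs.
record Diagram : Set₁ where
  field
    Cell          : Set
    pos           : Cell → ℕ × ℕ
    pos-injective : Injective _≡_ _≡_ pos

  row col : Cell → ℕ
  row u = proj₁ (pos u)
  col u = proj₂ (pos u)

-- The pair (i , j) of Fin's stands for the 1-based indices
-- suc (toℕ i) ∈ [ℓ(λ)] and suc (toℕ j) ∈ [λᵢ].
Index : List ℕ → Set
Index λs = Σ[ i ∈ Fin (length λs) ] Fin (lookup λs i)

youngDiagram : List ℕ → Diagram
youngDiagram λs = record
  { Cell = Index λs
  ; pos = λ (i , j) → suc (toℕ i) , suc (toℕ j)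
  ; pos-injective = inj
  }
  where
  inj : Injective _≡_ _≡_ (λ ((i , j) : Index λs) → (suc (toℕ i) , suc (toℕ j)))
  inj {i , j} {i′ , j′} eq with ,-injective eq
  ... | p , q with toℕ-injective (suc-injective p)
  ... | refl with toℕ-injective (suc-injective q)
  ... | refl = refl

shiftedDiagram : List ℕ → Diagram
shiftedDiagram λs = record
  { Cell = Index λs
  ; pos = λ (i , j) → suc (toℕ i) , suc (toℕ j) + suc (toℕ i) ∸ 1
  ; pos-injective = inj
  }
  where
  inj : Injective _≡_ _≡_
          (λ ((i , j) : Index λs) → (suc (toℕ i) , suc (toℕ j) + suc (toℕ i) ∸ 1))
  inj {i , j} {i′ , j′} eq with ,-injective eq
  ... | p , q with toℕ-injective (suc-injective p)
  ... | refl with toℕ-injective (+-cancelʳ-≡ (suc (toℕ i)) (toℕ j) (toℕ j′) q)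
  ... | refl = refl

module _ (D : Diagram) (n : ℕ) where
  open Diagram D

  record StandardTableau : Set where
    field
      filling    : Cell → Fin n
      bijective  : Bijective _≡_ _≡_ filling
      row-increasing : ∀ u v → row u ≡ row v → col u < col v →
                       filling u Fin.< filling v
      col-increasing : ∀ u v → col u ≡ col v → row u < row v →
                       filling u Fin.< filling v

    -- Fin n is 0-based, whereas the entries of a tableau are 1, …, n.
    entry : Cell → ℕ
    entry u = suc (toℕ (filling u))

  open StandardTableau

  -- Tableaux are identified when they have the same entries.
  _≈ᵀ_ : StandardTableau → StandardTableau → Set
  T ≈ᵀ T′ = ∀ u → entry T u ≡ entry T′ u

  IsHorizontalAdjacency : StandardTableau → Cell → Set
  IsHorizontalAdjacency T u =
    ∃[ v ] pos v ≡ (row u , suc (col u)) × entry T v ≡ suc (entry T u)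

  HorizontalAdjacencies : ℕ → Setoid 0ℓ 0ℓ
  HorizontalAdjacencies c = record
    { Carrier = Σ[ (T , u) ∈ StandardTableau × Cell ]
                  IsHorizontalAdjacency T u × col u ≡ c
    ; _≈_ = λ ((T , u) , _) ((T′ , u′) , _) → T ≈ᵀ T′ × u ≡ u′
    ; isEquivalence = record
      { refl  = (λ _ → refl) , refl
      ; sym   = λ (p , q) → (λ w → sym (p w)) , sym q
      ; trans = λ (p , q) (p′ , q′) → (λ w → trans (p w) (p′ w)) , trans q q′
      }
    }

  -- For n = 0 there is no largest entry, hence no such tableau.
  LargestEntryInColumn≥ : ℕ → Setoid 0ℓ 0ℓ
  LargestEntryInColumn≥ k = record
    { Carrier = Σ[ T ∈ StandardTableau ] ∃[ u ] entry T u ≡ n × col u ≥ k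
    ; _≈_ = λ (T , _) (T′ , _) → T ≈ᵀ T′
    ; isEquivalence = record
      { refl  = λ _ → refl
      ; sym   = λ p w → sym (p w)
      ; trans = λ p p′ w → trans (p w) (p′ w)
      }
    }

_HasCardinality_ : Setoid 0ℓ 0ℓ → ℕ → Set
S HasCardinality N = Inverse S (setoid (Fin N))

SameNumber : Setoid 0ℓ 0ℓ → Setoid 0ℓ 0ℓ → Set
SameNumber A B = ∃[ N ] (A HasCardinality N) × (B HasCardinality N)

{-# OPTIONS --safe #-}
-- Let a(k) be the number of tableaux whose entry k lies in a column > c, and
-- h(k) the number of tableaux in which k and k + 1 form a horizontal adjacency
-- lying in column c.  Then a(k + 1) = a(k) + h(k).  Indeed, a tableau with both
-- k and k + 1 to the right of column c counts in both a's; if exactly one of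
-- them is there and they lie in different rows, exchanging k and k + 1 gives
-- again a tableau; and if they lie in the same row, then k is immediately to
-- the left of k + 1, so k is in column c.  Since the entry 1 is in column 1,
-- a(1) = 0, and the sum of all h(k) telescopes to a(n).
module Submission where

open import Data.Nat using (ℕ; zero; suc; _+_; _^_; _≤_; _<_; _≥_; _>_; z≤n; s≤s; _≤?_; _<?_)
open import Data.Nat.Properties using (suc-injective; ≤-refl; ≤-trans; ≤-antisym; ≤-reflexive; ≤-pred; <-trans; <-irrefl; <-asym; <-cmp; ≰⇒>; ≮⇒≥; <⇒≤; <⇒≢; ≤∧≢⇒<; m<n⇒m<1+n; n<1+n; n≢0⇒n>0; +-cancelʳ-<; +-monoˡ-<) renaming (_≟_ to _≟ℕ_)
open import Data.Fin as Fin using (Fin; zero; suc; toℕ; fromℕ<; funToFin; finToFun; combine)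
open import Data.Fin.Properties using (_≟_; all?; any?; toℕ<n; toℕ-injective; toℕ-fromℕ<; +↔⊎; finToFun-funToFin; funToFin-finToFin)
open import Data.Fin.Permutation.Components using (transpose)
open import Data.List using ([]; _∷_; sum; lookup)
open import Data.List.Relation.Unary.Linked using (Linked; _∷_)
open import Data.Product using (Σ; Σ-syntax; ∃-syntax; _×_; _,_; proj₁; proj₂)
open import Data.Sum using (_⊎_; inj₁; inj₂)
open import Data.Sum.Function.Propositional using (_⊎-↔_)
open import Data.Sum.Function.Setoid using (_⊎-inverse_)
open import Data.Sum.Relation.Binary.Pointwise using (_⊎ₛ_; inj₁; inj₂)
open import Function using (_∘_; _↔_; mk↔ₛ′; Inverse)
open import Function.Properties.Inverse using (↔-refl; ↔-sym; ↔-trans)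
import Function.Construct.Composition as Composition
import Function.Construct.Identity as Identity
import Function.Construct.Symmetry as Symmetry
open import Level using (0ℓ)
open import Relation.Binary.Bundles using (Setoid)
open import Relation.Binary.Definitions using (tri<; tri≈; tri>)
import Relation.Binary.Construct.On as On
open import Relation.Binary.PropositionalEquality using (_≡_; _≢_; _≗_; refl; sym; trans; cong; cong₂; subst; subst₂; setoid)
open import Relation.Nullary using (¬_; Dec; yes; no; contradiction)
open import Relation.Nullary.Decidable using (map′; _×-dec_; _→-dec_)
open import Defs

open Setoid using (Carrier)

-- Counting up to a setoid equality

module _ {A B : Setoid 0ℓ 0ℓ} where
  private
    module A = Setoid A
    module B = Setoid B

  -- Presents the bijection by its graph. The maps come from the two totality proofs, and every
  -- congruence and inverse law is an instance of `functional` or `cofunctional`, so the case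
  -- analysis that chose an image need not be replayed.
  relationInverse : (R : A.Carrier → B.Carrier → Set) →
    (∀ a → ∃[ b ] R a b) → (∀ b → ∃[ a ] R a b) →
    (∀ {a a′ b b′} → R a b → R a′ b′ → a A.≈ a′ → b B.≈ b′) →
    (∀ {a a′ b b′} → R a b → R a′ b′ → b B.≈ b′ → a A.≈ a′) →
    Inverse A B
  relationInverse R total cototal functional cofunctional = record
    { to        = λ a → proj₁ (total a)
    ; from      = λ b → proj₁ (cototal b)
    ; to-cong   = functional (proj₂ (total _)) (proj₂ (total _))
    ; from-cong = cofunctional (proj₂ (cototal _)) (proj₂ (cototal _))
    ; inverse   = functional (proj₂ (total _)) (proj₂ (cototal _))
                , cofunctional (proj₂ (cototal _)) (proj₂ (total _))
    }

  emptyInverse : ¬ A.Carrier → ¬ B.Carrier → Inverse A B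
  emptyInverse ¬a ¬b = record
    { to        = λ a → contradiction a ¬a
    ; from      = λ b → contradiction b ¬b
    ; to-cong   = λ {a} _ → contradiction a ¬a
    ; from-cong = λ {b} _ → contradiction b ¬b
    ; inverse   = (λ {b} _ → contradiction b ¬b) , (λ {a} _ → contradiction a ¬a)
    }

Restrict : (S : Setoid 0ℓ 0ℓ) → (Carrier S → Set) → Setoid 0ℓ 0ℓ
Restrict S P = On.setoid S (proj₁ {B = P})

restrict-all : (S : Setoid 0ℓ 0ℓ) {P : Carrier S → Set} → (∀ x → P x) →
               Inverse S (Restrict S P)
restrict-all S all = record
  { to        = λ x → x , all x
  ; from      = proj₁
  ; to-cong   = λ eq → eq
  ; from-cong = λ eq → eq
  ; inverse   = (λ eq → eq) , (λ eq → eq)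
  }

module _ (S : Setoid 0ℓ 0ℓ) (f : Carrier S → ℕ) where
  private module S = Setoid S

  -- Compatibility of `f` with the equality keeps equivalent elements from landing in different
  -- summands.
  restrict-<suc : (∀ {x y} → x S.≈ y → f x ≡ f y) → ∀ m →
    Inverse (Restrict S (λ x → f x < suc m))
            (Restrict S (λ x → f x < m) ⊎ₛ Restrict S (λ x → f x ≡ m))
  restrict-<suc f-cong m = relationInverse R total cototal
    (λ {a} {a′} {b} {b′} → functional {a} {a′} {b} {b′})
    (λ {a} {a′} {b} {b′} → cofunctional {a} {a′} {b} {b′})
    where
    Below = Restrict S (λ x → f x < suc m)
    Split = Restrict S (λ x → f x < m) ⊎ₛ Restrict S (λ x → f x ≡ m)

    R : Carrier Below → Carrier Split → Set
    R (x , _) (inj₁ (y , _)) = x S.≈ y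
    R (x , _) (inj₂ (y , _)) = x S.≈ y

    total : ∀ a → ∃[ b ] R a b
    total (x , fx<1+m) with f x <? m
    ... | yes fx<m = inj₁ (x , fx<m) , S.refl
    ... | no  fx≮m = inj₂ (x , ≤-antisym (≤-pred fx<1+m) (≮⇒≥ fx≮m)) , S.refl

    cototal : ∀ b → ∃[ a ] R a b
    cototal (inj₁ (y , fy<m)) = (y , m<n⇒m<1+n fy<m) , S.refl
    cototal (inj₂ (y , fy≡m)) = (y , s≤s (≤-reflexive fy≡m)) , S.refl

    square : ∀ {x x′ y y′} → x S.≈ y → x′ S.≈ y′ → x S.≈ x′ → y S.≈ y′
    square p q r = S.trans (S.sym p) (S.trans r q)

    functional : ∀ {a a′ b b′} → R a b → R a′ b′ →
                 Setoid._≈_ Below a a′ → Setoid._≈_ Split b b′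
    functional {b = inj₁ _} {inj₁ _} p q r = inj₁ (square p q r)
    functional {b = inj₁ (_ , y<)} {inj₂ (_ , y≡)} p q r =
      contradiction (trans (f-cong (square p q r)) y≡) (<⇒≢ y<)
    functional {b = inj₂ (_ , y≡)} {inj₁ (_ , y<)} p q r =
      contradiction (trans (sym (f-cong (square p q r))) y≡) (<⇒≢ y<)
    functional {b = inj₂ _} {inj₂ _} p q r = inj₂ (square p q r)

    cofunctional : ∀ {a a′ b b′} → R a b → R a′ b′ →
                   Setoid._≈_ Split b b′ → Setoid._≈_ Below a a′
    cofunctional p q (inj₁ r) = S.trans p (S.trans r (S.sym q))
    cofunctional p q (inj₂ r) = S.trans p (S.trans r (S.sym q))

-- Induction on `M`, deciding whether `zero` counts. `Restrict` compares first components only, so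
-- different proofs of `P i` are not counted twice.
subset-cardinality : ∀ {M} {P : Fin M → Set} → (∀ i → Dec (P i)) →
                     ∃[ N ] Restrict (setoid (Fin M)) P HasCardinality N
subset-cardinality {zero} P? = 0 , emptyInverse (λ ()) (λ ())
subset-cardinality {suc M} {P} P? with subset-cardinality (P? ∘ suc) | P? zero
... | N , count | no ¬p₀ =
  N , Composition.inverse
        (relationInverse R total cototal (λ { refl refl refl → refl }) (λ { refl refl refl → refl }))
        count
  where
  R : Σ (Fin (suc M)) P → Σ (Fin M) (P ∘ suc) → Set
  R (i , _) (j , _) = i ≡ suc j
  total : ∀ a → ∃[ b ] R a b
  total (zero , p)  = contradiction p ¬p₀
  total (suc i , p) = (i , p) , refl
  cototal : ∀ b → ∃[ a ] R a b
  cototal (i , p) = (suc i , p) , refl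
... | N , count | yes p₀ = suc N , record
  { to = to ; from = from ; to-cong = λ {x} {y} → to-cong {x} {y}
  ; from-cong = λ { refl → refl }
  ; inverse = (λ {y} {x} → inverseˡ {y} {x}) , λ {x} {y} → inverseʳ {x} {y} }
  where
  module C = Inverse count
  to : Σ (Fin (suc M)) P → Fin (suc N)
  to (zero , _)  = zero
  to (suc i , p) = suc (C.to (i , p))
  from : Fin (suc N) → Σ (Fin (suc M)) P
  from zero    = zero , p₀
  from (suc k) = suc (proj₁ (C.from k)) , proj₂ (C.from k)
  to-cong : ∀ {x y} → proj₁ x ≡ proj₁ y → to x ≡ to y
  to-cong {zero , _}  {zero , _}   refl = refl
  to-cong {suc i , p} {suc _ , p′} refl = cong suc (C.to-cong refl)
  inverseˡ : ∀ {k x} → proj₁ x ≡ proj₁ (from k) → to x ≡ k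
  inverseˡ {zero}  {zero , _}  refl = refl
  inverseˡ {suc k} {suc _ , _} refl = cong suc (C.inverseˡ refl)
  inverseʳ : ∀ {x k} → k ≡ to x → proj₁ (from k) ≡ proj₁ x
  inverseʳ {zero , _}  refl = refl
  inverseʳ {suc i , p} refl = cong suc (C.inverseʳ refl)

module _ (S : Setoid 0ℓ 0ℓ) where
  private module S = Setoid S

  -- The code identifies `S` with its image, a decidable subset of `Fin M`.
  code-cardinality : ∀ {M} (code : S.Carrier → Fin M) →
    (∀ {x y} → x S.≈ y → code x ≡ code y) →
    (∀ {x y} → code x ≡ code y → x S.≈ y) →
    (∀ i → Dec (∃[ x ] code x ≡ i)) →
    ∃[ N ] S HasCardinality N
  code-cardinality code code-cong code-injective image? with subset-cardinality image?
  ... | N , count = N , Composition.inverse toImage count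
    where
    toImage : Inverse S (Restrict (setoid _) (λ i → ∃[ x ] code x ≡ i))
    toImage = relationInverse (λ x (i , _) → code x ≡ i)
      (λ x → (code x , x , refl) , refl)
      (λ (i , x , eq) → x , eq)
      (λ { refl refl eq → code-cong eq })
      (λ { refl refl eq → code-injective eq })

-- Only the values of the function enter its number, so pointwise equality suffices and no function
-- extensionality is assumed.
funToFin-cong : ∀ {m n} {f g : Fin m → Fin n} → f ≗ g → funToFin f ≡ funToFin g
funToFin-cong {zero}  eq = refl
funToFin-cong {suc m} eq = cong₂ combine (eq zero) (funToFin-cong (eq ∘ suc))

-- Adjacent transpositions

-- The graph of the transposition of `a` and `b`, so that later proofs match on its three cases
-- instead of unfolding decisions of equality.
data Swapped {n} (a b : Fin n) : Fin n → Fin n → Set where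
  left  : Swapped a b a b
  right : Swapped a b b a
  other : ∀ {x} → x ≢ a → x ≢ b → Swapped a b x x

module AdjacentTransposition {n} {a b : Fin n} (b≡1+a : toℕ b ≡ suc (toℕ a)) where

  a≢b : a ≢ b
  a≢b refl = <-irrefl b≡1+a (n<1+n _)

  b≮a : ¬ b Fin.< a
  b≮a b<a = <-asym b<a (≤-reflexive (sym b≡1+a))

  τ : Fin n → Fin n
  τ = transpose a b

  τ-swapped : ∀ x → Swapped a b x (τ x)
  τ-swapped x with x ≟ a
  ... | yes refl = left
  ... | no x≢a with x ≟ b
  ...   | yes refl = right
  ...   | no x≢b   = other x≢a x≢b

  swapped-sym : ∀ {x y} → Swapped a b x y → Swapped a b y x
  swapped-sym left        = right
  swapped-sym right       = left
  swapped-sym (other p q) = other p q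

  swapped-functional : ∀ {x y z} → Swapped a b x y → Swapped a b x z → y ≡ z
  swapped-functional left        left        = refl
  swapped-functional left        right       = contradiction refl a≢b
  swapped-functional left        (other p _) = contradiction refl p
  swapped-functional right       left        = contradiction refl a≢b
  swapped-functional right       right       = refl
  swapped-functional right       (other _ q) = contradiction refl q
  swapped-functional (other p _) left        = contradiction refl p
  swapped-functional (other _ q) right       = contradiction refl q
  swapped-functional (other _ _) (other _ _) = refl

  τ-unique : ∀ {x y} → Swapped a b x y → τ x ≡ y
  τ-unique = swapped-functional (τ-swapped _)

  τ-involutive : ∀ x → τ (τ x) ≡ x
  τ-involutive x = τ-unique (swapped-sym (τ-swapped x))

  τ-injective : ∀ {x y} → τ x ≡ τ y → x ≡ y
  τ-injective eq = trans (sym (τ-involutive _)) (trans (cong τ eq) (τ-involutive _))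

  τx≡b⇒x≡a : ∀ {x} → τ x ≡ b → x ≡ a
  τx≡b⇒x≡a eq = τ-injective (trans eq (sym (τ-unique left)))

  τx≡a⇒x≡b : ∀ {x} → τ x ≡ a → x ≡ b
  τx≡a⇒x≡b eq = τ-injective (trans eq (sym (τ-unique right)))

  -- No value lies strictly between `a` and `b`, so any third value compares with both in the same
  -- way; the only inequality that the swap reverses is `a < b` itself.
  swapped-mono-< : ∀ {x x′ y y′} → Swapped a b x x′ → Swapped a b y y′ →
                   ¬ (x ≡ a × y ≡ b) → x Fin.< y → x′ Fin.< y′
  swapped-mono-< left left _ a<a = contradiction a<a (<-irrefl refl)
  swapped-mono-< left right ¬ab _ = contradiction (refl , refl) ¬ab
  swapped-mono-< left (other _ y≢b) _ a<y =
    ≤∧≢⇒< (subst (_≤ _) (sym b≡1+a) a<y) (λ eq → y≢b (sym (toℕ-injective eq)))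
  swapped-mono-< right left _ b<a = contradiction b<a b≮a
  swapped-mono-< right right _ b<b = contradiction b<b (<-irrefl refl)
  swapped-mono-< right (other _ _) _ b<y = <-trans (≤-reflexive (sym b≡1+a)) b<y
  swapped-mono-< (other _ _) left _ x<a = <-trans x<a (≤-reflexive (sym b≡1+a))
  swapped-mono-< (other x≢a _) right _ x<b =
    ≤∧≢⇒< (≤-pred (subst (_ <_) b≡1+a x<b)) (λ eq → x≢a (toℕ-injective eq))
  swapped-mono-< (other _ _) (other _ _) _ x<y = x<y

  τ-mono-< : ∀ {x y} → ¬ (x ≡ a × y ≡ b) → x Fin.< y → τ x Fin.< τ y
  τ-mono-< = swapped-mono-< (τ-swapped _) (τ-swapped _)

-- Tableaux

-- Used to show that consecutive entries in one row occupy neighbouring cells.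
RowsConnected : Diagram → Set
RowsConnected D = ∀ u v → row u ≡ row v → col u < col v → ∃[ w ] pos w ≡ (row u , suc (col u))
  where open Diagram D

-- The cell `w` must carry a smaller entry than `u`, which keeps the entry 1 in column 1. The second
-- alternative is there for shifted shapes, where a diagonal cell has nothing to its left.
StartsInColumn1 : Diagram → Set
StartsInColumn1 D = ∀ u → 1 < col u →
  ∃[ w ] ((row w ≡ row u × col w < col u) ⊎ (col w ≡ col u × row w < row u))
  where open Diagram D

module Tableaux (D : Diagram) (n : ℕ) where
  open Diagram D
  open StandardTableau

  Tableau : Set
  Tableau = StandardTableau D n

  _≋_ : Tableau → Tableau → Set
  T ≋ T′ = filling T ≗ filling T′

  ≈⇒≋ : ∀ (T T′ : Tableau) → _≈ᵀ_ D n T T′ → T ≋ T′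
  ≈⇒≋ _ _ eq u = toℕ-injective (suc-injective (eq u))

  ≋⇒≈ : ∀ (T T′ : Tableau) → T ≋ T′ → _≈ᵀ_ D n T T′
  ≋⇒≈ _ _ eq u = cong (suc ∘ toℕ) (eq u)

  cellOf : ∀ (T : Tableau) (k : Fin n) → ∃[ u ] filling T u ≡ k
  cellOf T k with proj₂ (bijective T) k
  ... | u , eq = u , eq refl

  cell-unique : ∀ (T : Tableau) {u v k} → filling T u ≡ k → filling T v ≡ k → u ≡ v
  cell-unique T p q = proj₁ (bijective T) (trans p (sym q))

  -- LargestEntryInColumn≥ k is, definitionally, the case m = n.
  EntryInColumn≥ : ℕ → ℕ → Setoid 0ℓ 0ℓ
  EntryInColumn≥ k m = record
    { Carrier = Σ[ T ∈ Tableau ] ∃[ u ] entry T u ≡ m × col u ≥ k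
    ; _≈_ = λ (T , _) (T′ , _) → _≈ᵀ_ D n T T′
    ; isEquivalence = record
      { refl  = λ _ → refl
      ; sym   = λ p w → sym (p w)
      ; trans = λ p p′ w → trans (p w) (p′ w)
      }
    }

  -- Exchanging two consecutive entries of a tableau.

  module Exchange {a b : Fin n} (b≡1+a : toℕ b ≡ suc (toℕ a)) where
    open AdjacentTransposition b≡1+a public

    -- Exactly what an exchange requires: the cells of `a` and `b` are never compared by the row or
    -- column condition, so the one inequality reversed by `τ` is never demanded.
    Separated : Tableau → Set
    Separated T = ∀ {u v} → filling T u ≡ a → filling T v ≡ b → row u ≢ row v × col u ≢ col v

    exchange : (T : Tableau) → Separated T → Tableau
    exchange T sep = record
      { filling = τ ∘ filling T
      ; bijective = (λ eq → proj₁ (bijective T) (τ-injective eq))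
                  , (λ k → let (u , eq) = cellOf T (τ k) in
                       u , λ { refl → trans (cong τ eq) (τ-involutive k) })
      ; row-increasing = λ u v row≡ col< →
          τ-mono-< (λ (p , q) → proj₁ (sep p q) row≡) (row-increasing T u v row≡ col<)
      ; col-increasing = λ u v col≡ row< →
          τ-mono-< (λ (p , q) → proj₂ (sep p q) col≡) (col-increasing T u v col≡ row<)
      }

    -- The same two cells carry `a` and `b` in `T′`, with their roles interchanged.
    exchange-separated : ∀ {T T′ : Tableau} → filling T′ ≗ τ ∘ filling T → Separated T → Separated T′
    exchange-separated eq sep p q =
      let (r , s) = sep (τx≡b⇒x≡a (trans (sym (eq _)) q)) (τx≡a⇒x≡b (trans (sym (eq _)) p))
      in (λ e → r (sym e)) , (λ e → s (sym e))

  -- The recursion from one entry to the next.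

  module _ (c : ℕ) (neighbour : RowsConnected D) where

    Adjacencies : Setoid 0ℓ 0ℓ
    Adjacencies = HorizontalAdjacencies D n c

    position : Carrier Adjacencies → ℕ
    position ((T , u) , _) = entry T u

    position-cong : ∀ {x y} → Setoid._≈_ Adjacencies x y → position x ≡ position y
    position-cong (eq , refl) = eq _

    module _ (m : ℕ) (2+m≤n : suc (suc m) ≤ n) where
      private
        -- Values of fillings are 0-based: `a` and `b` stand for the entries `suc m` and
        -- `suc (suc m)`.
        a b : Fin n
        a = fromℕ< (<⇒≤ 2+m≤n)
        b = fromℕ< 2+m≤n

        toℕa : toℕ a ≡ m
        toℕa = toℕ-fromℕ< _

        toℕb : toℕ b ≡ suc m
        toℕb = toℕ-fromℕ< _

      open Exchange (trans toℕb (cong suc (sym toℕa)))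

      private
        ≡a : ∀ (T : Tableau) {u} → entry T u ≡ suc m → filling T u ≡ a
        ≡a T eq = toℕ-injective (trans (suc-injective eq) (sym toℕa))

        ≡b : ∀ (T : Tableau) {u} → entry T u ≡ suc (suc m) → filling T u ≡ b
        ≡b T eq = toℕ-injective (trans (suc-injective eq) (sym toℕb))

        a≡ : ∀ (T : Tableau) {u} → filling T u ≡ a → entry T u ≡ suc m
        a≡ T eq = cong suc (trans (cong toℕ eq) toℕa)

        b≡ : ∀ (T : Tableau) {u} → filling T u ≡ b → entry T u ≡ suc (suc m)
        b≡ T eq = cong suc (trans (cong toℕ eq) toℕb)

        A B J : Setoid 0ℓ 0ℓ
        A = EntryInColumn≥ (suc c) (suc (suc m))
        B = EntryInColumn≥ (suc c) (suc m)
        J = Restrict Adjacencies (λ x → position x ≡ suc m)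

        High Low : Tableau → Set
        High T = ∀ {u} → filling T u ≡ a → col u > c
        Low  T = ∀ {u} → filling T u ≡ a → col u ≤ c

        -- A tableau is kept, exchanged, or read as an adjacency. `High`, `Low` and `Separated` are
        -- recorded to make the three cases mutually exclusive. The cell of an adjacency is left
        -- out, being determined as the cell of `a`.
        R : Carrier A → Carrier (B ⊎ₛ J) → Set
        R (T , _) (inj₁ (T′ , _)) = (T ≋ T′ × High T) ⊎ (filling T′ ≗ τ ∘ filling T × Low T × Separated T)
        R (T , _) (inj₂ (((T′ , _) , _) , _)) = T ≋ T′

        at : ∀ {T : Tableau} {u} (P : Cell → Set) → filling T u ≡ a → P u → ∀ {w} → filling T w ≡ a → P w
        at {T} P p Pu q = subst P (cell-unique T p q) Pu

        separated : ∀ (T : Tableau) {u v} → filling T u ≡ a → filling T v ≡ b →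
                    row u ≢ row v → col u ≢ col v → Separated T
        separated T p q r s p′ q′ with cell-unique T p p′ | cell-unique T q q′
        ... | refl | refl = r , s

        -- Let `w` be the right neighbour of `u`. If `w` came before `v`, its value would lie
        -- strictly between `a` and `b`; and `w` cannot come after `v`, because `col u < col v`. So
        -- `v` is in the column of `w`, and `col u ≤ c < suc (col u)` forces `col u ≡ c`.
        adjacent : ∀ (T : Tableau) {u v} → filling T u ≡ a → filling T v ≡ b → row u ≡ row v →
                   col u ≤ c → c < col v → pos v ≡ (row u , suc (col u)) × col u ≡ c
        adjacent T {u} {v} p q row≡ u≤c c<v with neighbour u v row≡ (≤-trans (s≤s u≤c) c<v)
        ... | w , pos≡ with <-cmp (col w) (col v)
        ...   | tri< w<v _ _ =
          contradiction (≤-trans (s≤s (subst (Fin._< filling T w) p u<w))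
                                 (subst (filling T w Fin.<_) q
                                   (row-increasing T w v (trans (cong proj₁ pos≡) row≡) w<v)))
                        (λ 2+a≤b → <-irrefl (trans (cong suc toℕa) (sym toℕb)) 2+a≤b)
          where
          u<w : filling T u Fin.< filling T w
          u<w = row-increasing T u w (sym (cong proj₁ pos≡)) (≤-reflexive (sym (cong proj₂ pos≡)))
        ...   | tri≈ _ w≡v _ = cong₂ _,_ (sym row≡) v≡1+u
                             , ≤-antisym u≤c (≤-pred (subst (c <_) v≡1+u c<v))
          where
          v≡1+u : col v ≡ suc (col u)
          v≡1+u = trans (sym w≡v) (cong proj₂ pos≡)
        ...   | tri> _ _ v<w =
          contradiction (≤-trans (s≤s (≤-trans (s≤s u≤c) c<v)) v<w)
                        (<-irrefl (sym (cong proj₂ pos≡)))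

        total : ∀ x → ∃[ y ] R x y
        total (T , v , v≡ , v>c) with cellOf T a
        ... | u , u≡ with suc c ≤? col u
        ...   | yes u>c = inj₁ (T , u , a≡ T u≡ , u>c)
                        , inj₁ ((λ _ → refl) , at {T} (λ w → col w > c) u≡ u>c)
        ...   | no u≯c with row u ≟ℕ row v
        ...     | yes row≡ =
          let (pos≡ , u≡c) = adjacent T u≡ (≡b T v≡) row≡ (≤-pred (≰⇒> u≯c)) v>c in
          inj₂ (((T , u) , (v , pos≡ , trans v≡ (cong suc (sym (a≡ T u≡)))) , u≡c) , a≡ T u≡)
          , (λ _ → refl)
        -- The columns differ because `c` lies between them, so the exchange is allowed; it puts `a`
        -- into `v`, to the right of column `c`.
        ...     | no row≢ = inj₁ (T′ , v , a≡ T′ (trans (cong τ (≡b T v≡)) (τ-unique right)) , v>c)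
                          , inj₂ ((λ _ → refl) , at {T} (λ w → col w ≤ c) u≡ u≤c , sep)
          where
          u≤c : col u ≤ c
          u≤c = ≤-pred (≰⇒> u≯c)
          sep : Separated T
          sep = separated T u≡ (≡b T v≡) row≢ (<⇒≢ (≤-trans (s≤s u≤c) v>c))
          T′ : Tableau
          T′ = exchange T sep

        cototal : ∀ y → ∃[ x ] R x y
        cototal (inj₁ (T , u , u≡ , u>c)) with cellOf T b
        ... | v , v≡ with suc c ≤? col v
        ...   | yes v>c = (T , v , b≡ T v≡ , v>c)
                        , inj₁ ((λ _ → refl) , at {T} (λ w → col w > c) (≡a T u≡) u>c)
        -- Here `T` itself is not in `A`, so its preimage is the exchanged tableau. The cells are
        -- separated: in a common row the larger `b` would stand to the left of `a`, and the columns
        -- lie on different sides of `c`.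
        ...   | no v≯c  = (T′ , u , b≡ T′ (trans (cong τ (≡a T u≡)) (τ-unique left)) , u>c)
                        , inj₂ ((λ w → sym (τ-involutive _))
                               , at {T′} (λ w → col w ≤ c) (trans (cong τ v≡) (τ-unique right)) v≤c
                               , exchange-separated {T} {T′} (λ _ → refl) sep)
          where
          v≤c : col v ≤ c
          v≤c = ≤-pred (≰⇒> v≯c)
          v<u : col v < col u
          v<u = ≤-trans (s≤s v≤c) u>c
          sep : Separated T
          sep = separated T (≡a T u≡) v≡
            (λ row≡ → b≮a (subst₂ Fin._<_ v≡ (≡a T u≡) (row-increasing T v u (sym row≡) v<u)))
            (λ col≡ → <⇒≢ v<u (sym col≡))
          T′ : Tableau
          T′ = exchange T sep
        cototal (inj₂ (((T , u) , (v , pos≡ , v≡) , u≡c) , u≡)) =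
          (T , v , trans v≡ (cong suc u≡) , ≤-reflexive (sym (trans (cong proj₂ pos≡) (cong suc u≡c))))
          , (λ _ → refl)

        ¬high-low : ∀ (T T′ : Tableau) → T ≋ T′ → High T → ¬ Low T′
        ¬high-low T T′ eq high low with cellOf T a
        ... | u , u≡ = <-irrefl refl (≤-trans (high u≡) (low (trans (sym (eq u)) u≡)))

        -- An adjacency has `a` in column `c`, against `High`, and `b` in the same row as `a`,
        -- against `Separated`.
        ¬adjacent : ∀ (T : Tableau) (z : Carrier J) → T ≋ proj₁ (proj₁ (proj₁ z)) → ¬ (High T ⊎ Separated T)
        ¬adjacent T (((T′ , u) , _ , u≡c) , u≡) eq (inj₁ high) =
          <-irrefl (sym u≡c) (high (trans (eq u) (≡a T′ u≡)))
        ¬adjacent T (((T′ , u) , (v , pos≡ , v≡) , _) , u≡) eq (inj₂ sep) =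
          proj₁ (sep (trans (eq u) (≡a T′ u≡)) (trans (eq v) (≡b T′ (trans v≡ (cong suc u≡)))))
                (sym (cong proj₁ pos≡))

        ¬case₁-case₂ : ∀ x y (T : Tableau) → R x (inj₁ y) → (z : Carrier J) → proj₁ x ≋ T →
                       ¬ T ≋ proj₁ (proj₁ (proj₁ z))
        ¬case₁-case₂ (S , _) _ T (inj₁ (_ , high)) z eq eq′ =
          ¬adjacent S z (λ w → trans (eq w) (eq′ w)) (inj₁ high)
        ¬case₁-case₂ (S , _) _ T (inj₂ (_ , _ , sep)) z eq eq′ =
          ¬adjacent S z (λ w → trans (eq w) (eq′ w)) (inj₂ sep)

        functional : ∀ x x′ y y′ → R x y → R x′ y′ →
                     proj₁ x ≋ proj₁ x′ → Setoid._≈_ (B ⊎ₛ J) y y′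
        functional _ _ (inj₁ (T , _)) (inj₁ (T′ , _)) (inj₁ (p , _)) (inj₁ (q , _)) eq =
          inj₁ (≋⇒≈ T T′ (λ w → trans (sym (p w)) (trans (eq w) (q w))))
        functional (S , _) (S′ , _) (inj₁ _) (inj₁ _) (inj₁ (_ , high)) (inj₂ (_ , low , _)) eq =
          contradiction (λ {u} → low {u}) (¬high-low S S′ eq high)
        functional (S , _) (S′ , _) (inj₁ _) (inj₁ _) (inj₂ (_ , low , _)) (inj₁ (_ , high)) eq =
          contradiction (λ {u} → low {u}) (¬high-low S′ S (λ w → sym (eq w)) high)
        functional _ _ (inj₁ (T , _)) (inj₁ (T′ , _)) (inj₂ (p , _)) (inj₂ (q , _)) eq =
          inj₁ (≋⇒≈ T T′ (λ w → trans (p w) (trans (cong τ (eq w)) (sym (q w)))))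
        functional x x′ (inj₁ y) (inj₂ z) p q eq =
          contradiction q (¬case₁-case₂ x y (proj₁ x′) p z eq)
        functional x x′ (inj₂ z) (inj₁ y) p q eq =
          contradiction p (¬case₁-case₂ x′ y (proj₁ x) q z (λ w → sym (eq w)))
        -- Equality in `J` also asks for equal cells; both are the unique cell carrying `a`.
        functional _ _ (inj₂ (((T , u) , _) , u≡)) (inj₂ (((T′ , u′) , _) , u′≡)) p q eq =
          inj₂ (≋⇒≈ T T′ T≋T′ , cell-unique T (≡a T u≡) (trans (T≋T′ u′) (≡a T′ u′≡)))
          where
          T≋T′ : T ≋ T′
          T≋T′ w = trans (sym (p w)) (trans (eq w) (q w))

        -- The cell of `b` in `x` lies to the right of column `c` and carries `a` in `S`. Hence no
        -- element of `B` arises both by keeping and by exchanging.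
        ¬stay-exchange : (x : Carrier A) (S : Tableau) → filling (proj₁ x) ≗ τ ∘ filling S → ¬ Low S
        ¬stay-exchange (T , v , v≡ , v>c) S eq low =
          <-irrefl refl (≤-trans v>c (low (τx≡b⇒x≡a (trans (sym (eq v)) (≡b T v≡)))))

        cofunctional : ∀ x x′ y y′ → R x y → R x′ y′ →
                       Setoid._≈_ (B ⊎ₛ J) y y′ → proj₁ x ≋ proj₁ x′
        cofunctional _ _ (inj₁ (T , _)) (inj₁ (T′ , _)) (inj₁ (p , _)) (inj₁ (q , _)) (inj₁ eq) w =
          trans (p w) (trans (≈⇒≋ T T′ eq w) (sym (q w)))
        cofunctional x (S′ , _) (inj₁ (T , _)) (inj₁ (T′ , _)) (inj₁ (p , _)) (inj₂ (q , low , _)) (inj₁ eq) =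
          contradiction (λ {u} → low {u})
            (¬stay-exchange x S′ (λ w → trans (p w) (trans (≈⇒≋ T T′ eq w) (q w))))
        cofunctional (S , _) x′ (inj₁ (T , _)) (inj₁ (T′ , _)) (inj₂ (p , low , _)) (inj₁ (q , _)) (inj₁ eq) =
          contradiction (λ {u} → low {u})
            (¬stay-exchange x′ S (λ w → trans (q w) (trans (sym (≈⇒≋ T T′ eq w)) (p w))))
        cofunctional _ _ (inj₁ (T , _)) (inj₁ (T′ , _)) (inj₂ (p , _)) (inj₂ (q , _)) (inj₁ eq) w =
          τ-injective (trans (sym (p w)) (trans (≈⇒≋ T T′ eq w) (q w)))
        cofunctional _ _ (inj₂ (((T , _) , _) , _)) (inj₂ (((T′ , _) , _) , _)) p q (inj₂ (eq , _)) w =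
          trans (p w) (trans (≈⇒≋ T T′ eq w) (sym (q w)))

      column-step : Inverse A (B ⊎ₛ J)
      column-step = relationInverse R total cototal
        (λ {x} {x′} {y} {y′} p q eq → functional x x′ y y′ p q (≈⇒≋ (proj₁ x) (proj₁ x′) eq))
        (λ {x} {x′} {y} {y′} p q eq → ≋⇒≈ (proj₁ x) (proj₁ x′) (cofunctional x x′ y y′ p q eq))

    -- Telescoping from the first entry to the largest.

    module _ (c≥1 : c ≥ 1) (predecessor : StartsInColumn1 D) where

      ¬first-entry : ¬ Carrier (EntryInColumn≥ (suc c) 1)
      ¬first-entry (T , u , u≡ , u>c) with predecessor u (≤-trans (s≤s c≥1) u>c)
      ... | w , inj₁ (row≡ , col<) =
        contradiction (subst (toℕ (filling T w) <_) (suc-injective u≡) (row-increasing T w u row≡ col<)) (λ ())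
      ... | w , inj₂ (col≡ , row<) =
        contradiction (subst (toℕ (filling T w) <_) (suc-injective u≡) (col-increasing T w u col≡ row<)) (λ ())

      -- The adjacencies with position below `m` represent the partial sum h(1) + ... + h(m - 1).
      telescope : ∀ m → m ≤ n →
        Inverse (EntryInColumn≥ (suc c) m) (Restrict Adjacencies (λ x → position x < m))
      -- Entries and positions start at 1, so both sides are empty here; this case also covers `n`
      -- equal to 0.
      telescope zero _ = emptyInverse (λ { (_ , _ , () , _) }) (λ { (_ , ()) })
      telescope (suc zero) _ = emptyInverse ¬first-entry (λ { (_ , s≤s ()) })
      telescope (suc (suc m)) 2+m≤n =
        Composition.inverse (column-step m 2+m≤n)
          (Composition.inverse
            (telescope (suc m) (<⇒≤ 2+m≤n) ⊎-inverse Identity.inverse _)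
            (Symmetry.inverse (restrict-<suc Adjacencies position (λ {x} {y} → position-cong {x} {y}) (suc m))))

      -- The right neighbour carries the next entry, itself at most `n`. So for `m` equal to `n` the
      -- bound in `telescope` excludes no adjacency.
      position<n : ∀ x → position x < n
      position<n ((T , u) , (v , _ , v≡) , _) = subst (_≤ n) v≡ (toℕ<n (filling T v))

      adjacencies↔largest : Inverse Adjacencies (LargestEntryInColumn≥ D n (suc c))
      adjacencies↔largest =
        Composition.inverse (restrict-all Adjacencies position<n)
          (Symmetry.inverse (telescope n ≤-refl))

  -- Finiteness of the sets of tableaux.

  module _ {M} (cells : Cell ↔ Fin M) where
    private module Cells = Inverse cells

    allCells? : ∀ {P : Cell → Set} → (∀ u → Dec (P u)) → Dec (∀ u → P u)
    allCells? {P} P? = map′ (λ p u → subst P (Cells.strictlyInverseʳ u) (p (Cells.to u)))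
                            (λ p → p ∘ Cells.from) (all? (P? ∘ Cells.from))

    anyCell? : ∀ {P : Cell → Set} → (∀ u → Dec (P u)) → Dec (∃[ u ] P u)
    anyCell? {P} P? = map′ (λ (i , p) → Cells.from i , p)
                           (λ (u , p) → Cells.to u , subst P (sym (Cells.strictlyInverseʳ u)) p)
                           (any? (P? ∘ Cells.from))

    IsStandard : (Cell → Fin n) → Set
    IsStandard f = (∀ u v → f u ≡ f v → u ≡ v) × (∀ k → ∃[ u ] f u ≡ k)
      × (∀ u v → row u ≡ row v → col u < col v → f u Fin.< f v)
      × (∀ u v → col u ≡ col v → row u < row v → f u Fin.< f v)

    isStandard? : ∀ f → Dec (IsStandard f)
    isStandard? f =
      allCells? (λ u → allCells? λ v → (f u ≟ f v) →-dec (u ≟ᶜ v))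
      ×-dec all? (λ k → anyCell? λ u → f u ≟ k)
      ×-dec allCells? (λ u → allCells? λ v →
              (row u ≟ℕ row v) →-dec ((col u <? col v) →-dec (f u Fin.<? f v)))
      ×-dec allCells? (λ u → allCells? λ v →
              (col u ≟ℕ col v) →-dec ((row u <? row v) →-dec (f u Fin.<? f v)))
      where
      _≟ᶜ_ : (u v : Cell) → Dec (u ≡ v)
      u ≟ᶜ v = map′ (λ eq → trans (sym (Cells.strictlyInverseʳ u))
                              (trans (cong Cells.from eq) (Cells.strictlyInverseʳ v)))
                    (cong Cells.to) (Cells.to u ≟ Cells.to v)

    toTableau : ∀ {f} → IsStandard f → Tableau
    toTableau {f} (inj , sur , rows , cols) = record
      { filling = f
      ; bijective = (λ {u} {v} → inj u v) , (λ k → let (u , eq) = sur k in u , λ { refl → eq })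
      ; row-increasing = rows
      ; col-increasing = cols
      }

    isStandard : ∀ {f} (T : Tableau) → filling T ≗ f → IsStandard f
    isStandard T eq =
      (λ u v e → proj₁ (bijective T) (trans (eq u) (trans e (sym (eq v)))))
      , (λ k → let (u , e) = cellOf T k in u , trans (sym (eq u)) e)
      , (λ u v r s → subst₂ Fin._<_ (eq u) (eq v) (row-increasing T u v r s))
      , (λ u v r s → subst₂ Fin._<_ (eq u) (eq v) (col-increasing T u v r s))

    -- Numbering the cells turns a filling into a word of length `M` over `Fin n`, encoded as a
    -- single number.
    code : Tableau → Fin (n ^ M)
    code T = funToFin (filling T ∘ Cells.from)

    decode : Fin (n ^ M) → Cell → Fin n
    decode i = finToFun i ∘ Cells.to

    decode-code : ∀ (T : Tableau) → filling T ≗ decode (code T)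
    decode-code T u = sym (trans (finToFun-funToFin _ (Cells.to u)) (cong (filling T) (Cells.strictlyInverseʳ u)))

    code-toTableau : ∀ i (std : IsStandard (decode i)) → code (toTableau std) ≡ i
    code-toTableau i std =
      trans (funToFin-cong (λ j → cong (finToFun i) (Cells.strictlyInverseˡ j))) (funToFin-finToFin {M} i)

    column-finite : ∀ k m → ∃[ N ] EntryInColumn≥ k m HasCardinality N
    column-finite k m = code-cardinality (EntryInColumn≥ k m) (code ∘ proj₁)
      (λ {(T , _)} {(T′ , _)} eq → funToFin-cong {M} (λ j → ≈⇒≋ T T′ eq (Cells.from j)))
      (λ {(T , _)} {(T′ , _)} eq → ≋⇒≈ T T′
        (λ u → trans (decode-code T u) (trans (cong (λ i → decode i u) eq) (sym (decode-code T′ u)))))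
      -- The image is decidable: `i` is a code exactly when its decoding is standard and has the
      -- entry `m` in a column at least `k`, both being finite checks.
      (λ i → map′
        (λ (std , u , u≡ , u≥k) → (toTableau std , u , u≡ , u≥k) , code-toTableau i std)
        (λ { ((T , u , u≡ , u≥k) , refl) →
          isStandard T (decode-code T) , u , trans (cong (suc ∘ toℕ) (sym (decode-code T u))) u≡ , u≥k })
        (isStandard? (decode i)
          ×-dec anyCell? (λ u → (suc (toℕ (decode i u)) ≟ℕ m) ×-dec (k ≤? col u))))

    adjacencies-sameNumber : ∀ c → c ≥ 1 → RowsConnected D → StartsInColumn1 D →
      SameNumber (HorizontalAdjacencies D n c) (LargestEntryInColumn≥ D n (suc c))
    adjacencies-sameNumber c c≥1 neighbour predecessor with column-finite (suc c) n
    -- Only the tableaux are counted directly; the adjacencies inherit the count through the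
    -- bijection.
    ... | N , count = N , Composition.inverse (adjacencies↔largest c neighbour c≥1 predecessor) count , count

-- Young diagrams and shifted Young diagrams

index↔fin : ∀ xs → Index xs ↔ Fin (sum xs)
index↔fin [] = mk↔ₛ′ (λ { (() , _) }) (λ ()) (λ ()) (λ { (() , _) })
index↔fin (x ∷ xs) =
  ↔-trans splitRow (↔-trans (↔-refl ⊎-↔ index↔fin xs) (↔-sym +↔⊎))
  where
  splitRow : Index (x ∷ xs) ↔ (Fin x ⊎ Index xs)
  splitRow = mk↔ₛ′ (λ { (zero , j) → inj₁ j ; (suc i , j) → inj₂ (i , j) })
                   (λ { (inj₁ j) → zero , j ; (inj₂ (i , j)) → suc i , j })
                   (λ { (inj₁ _) → refl ; (inj₂ _) → refl })
                   (λ { (zero , _) → refl ; (suc _ , _) → refl })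

fin-next : ∀ {m} (j j′ : Fin m) → toℕ j < toℕ j′ → ∃[ k ] toℕ {m} k ≡ suc (toℕ j)
fin-next j j′ j<j′ = fromℕ< 1+j<m , toℕ-fromℕ< 1+j<m
  where 1+j<m = ≤-trans (s≤s j<j′) (toℕ<n j′)

-- Row `i` of `xs` is row `suc i` of `x ∷ xs`, so `k` indexes the row directly above it. The two
-- indices have different `Fin` types and are compared through `toℕ`.
row-above : ∀ {x xs} → Linked _>_ (x ∷ xs) → ∀ i →
            ∃[ k ] toℕ k ≡ toℕ i × lookup (x ∷ xs) k > lookup xs i
row-above (x>y ∷ _) zero = zero , refl , x>y
row-above (_ ∷ decreasing) (suc i) with row-above decreasing i
... | k , k≡i , above = suc k , cong suc k≡i , above

-- In a strict partition the row above a nonempty row has at least two cells.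
above-diagonal : ∀ {xs} → Linked _>_ xs → ∀ i → Fin (lookup xs i) → 0 < toℕ i →
  ∃[ i′ ] Σ[ j′ ∈ Fin (lookup xs i′) ] toℕ i ≡ suc (toℕ i′) × toℕ j′ ≡ 1
above-diagonal {x ∷ xs} decreasing (suc i) j _ with row-above decreasing i
... | i′ , i′≡i , above = i′ , fromℕ< 1<row , cong suc (sym i′≡i) , toℕ-fromℕ< 1<row
  where 1<row = ≤-trans (s≤s (≤-trans (s≤s z≤n) (toℕ<n j))) above

young-rowsConnected : ∀ xs → RowsConnected (youngDiagram xs)
young-rowsConnected xs (i , j) (i′ , j′) row≡ (s≤s j<j′) with toℕ-injective (suc-injective row≡)
... | refl with fin-next j j′ j<j′
...   | k , k≡ = (i , k) , cong (λ x → suc (toℕ i) , suc x) k≡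

young-startsInColumn1 : ∀ xs → StartsInColumn1 (youngDiagram xs)
young-startsInColumn1 xs (i , j) (s≤s 0<j) =
  (i , first) , inj₁ (refl , s≤s (subst (_< toℕ j) (sym (toℕ-fromℕ< _)) 0<j))
  where first = fromℕ< (≤-trans (s≤s z≤n) (toℕ<n j))

shifted-rowsConnected : ∀ xs → RowsConnected (shiftedDiagram xs)
shifted-rowsConnected xs (i , j) (i′ , j′) row≡ j<j′ with toℕ-injective (suc-injective row≡)
... | refl with fin-next j j′ (+-cancelʳ-< (suc (toℕ i)) (toℕ j) (toℕ j′) j<j′)
...   | k , k≡ = (i , k) , cong (λ x → suc (toℕ i) , x + suc (toℕ i)) k≡

-- A cell off the diagonal has the diagonal cell of its row to its left. A diagonal cell beyond
-- column 1 lies under the second cell of the previous row, which starts one column earlier.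
shifted-startsInColumn1 : ∀ {xs} → Linked _>_ xs → StartsInColumn1 (shiftedDiagram xs)
shifted-startsInColumn1 decreasing (i , j) 1<col with toℕ j ≟ℕ 0
... | no j≢0 = (i , first) , inj₁ (refl , +-monoˡ-< (suc (toℕ i)) first<j)
  where
  first = fromℕ< (≤-trans (s≤s z≤n) (toℕ<n j))
  first<j = subst (_< toℕ j) (sym (toℕ-fromℕ< _)) (n≢0⇒n>0 j≢0)
-- With `toℕ j` zero the column is `suc (toℕ i)`, so `1<col` says that there is a row above.
... | yes j≡0 with above-diagonal decreasing i j (≤-pred (subst (λ x → 1 < x + suc (toℕ i)) j≡0 1<col))
...   | i′ , j′ , i≡ , j′≡1 = (i′ , j′) , inj₂ (col≡ , s≤s (≤-reflexive (sym i≡)))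
  where
  col≡ : toℕ j′ + suc (toℕ i′) ≡ toℕ j + suc (toℕ i)
  col≡ = trans (cong (_+ suc (toℕ i′)) j′≡1)
           (trans (cong suc (sym i≡)) (cong (_+ suc (toℕ i)) (sym j≡0)))

mainTheorem11 : ((p : Partition) (c : ℕ) → c ≥ 1 →
    let open Partition p in
    SameNumber
    (HorizontalAdjacencies (youngDiagram parts) (sum parts) c)
    (LargestEntryInColumn≥ (youngDiagram parts) (sum parts) (suc c)))
    ×
    ((p : StrictPartition) (c : ℕ) → c ≥ 1 →
    let open StrictPartition p in
    SameNumber
    (HorizontalAdjacencies (shiftedDiagram parts) (sum parts) c)
    (LargestEntryInColumn≥ (shiftedDiagram parts) (sum parts) (suc c)))
mainTheorem11 =
  (λ p c c≥1 → let open Partition p in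
    Tableaux.adjacencies-sameNumber (youngDiagram parts) (sum parts) (index↔fin parts) c c≥1
      (young-rowsConnected parts) (young-startsInColumn1 parts))
  , (λ p c c≥1 → let open StrictPartition p in
    Tableaux.adjacencies-sameNumber (shiftedDiagram parts) (sum parts) (index↔fin parts) c c≥1
      (shifted-rowsConnected parts) (shifted-startsInColumn1 decreasing))
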